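{- Let $\mathbf P=(P,\leq,*,1)$ be a strongly sectionally pseudocomplemented poset, $n\geq1$, $a,a_1,\ldots,a_n,b\in P$ and $\Theta\in\operatorname{Con}\mathbf P$. Then the following hold: (i) if $a\leq b$ then $[a]\Theta\leq'[b]\Theta$; (ii) $[a]\Theta\leq'[b]\Theta$ if and only if there exists some $c\in[b]\Theta$ with $a\leq c$; (iii) $(P/\Theta,\leq')$ is a poset; (iv) every class of $\Theta$ is up-directed (with respect to the order induced by $\leq$); (v) $U([a_1]\Theta,\ldots,[a_n]\Theta)=\{[x]\Theta\mid x\in U(a_1,\ldots,a_n)\}$, where the left-hand side is taken in $(P/\Theta,\leq')$.
   Context: For a poset $(P,\leq)$ and $A\subseteq P$, $U(A)$ and $L(A)$ denote the sets of all upper, respectively lower, bounds of $A$; $U(a_1,\ldots,a_n)=U(\{a_1,\ldots,a_n\})$, $L(b)=L(\{b\})$, $L(U(a,b),c)=L(U(a,b)\cup\{c\})$. The poset is sectionally pseudocomplemented if for all $a,b\in P$ there exists a greatest element $c$ of $P$ with $L(U(a,b),c)=L(b)$; this $c$ is denoted by $a*b$, and one writes $(P,\leq,*)$. A strongly sectionally pseudocomplemented poset is a quadruple $(P,\leq,*,1)$ such that $(P,\leq,*)$ is a sectionally pseudocomplemented poset with greatest element $1$ satisfying $x\leq(x*y)*y$ for all $x,y\in P$. A binary relation $\rho$ on $P$ is $\min$-stable if whenever $(a,b),(c,d)\in\rho$, $a$ is comparable with $c$ and $b$ is comparable with $d$, then $(\min(a,c),\min(b,d))\in\rho$. A congruence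 on $\mathbf P$ is a $\min$-stable congruence on the algebra $(P,*,1)$; $\operatorname{Con}\mathbf P$ is the set of all of them. On $P/\Theta$ the operation is $[a]\Theta*[b]\Theta=[a*b]\Theta$, and the binary relation $\leq'$ on $P/\Theta$ is defined by: $[a]\Theta\leq'[b]\Theta$ if and only if $[a]\Theta*[b]\Theta=[1]\Theta$. A poset is up-directed if any two of its elements have a common upper bound in it. -}

module Defs where

open import Algebra.Bundles using (Magma)
open import Algebra.Core using (Op₂)
open import Algebra.Definitions using (Congruent₂)
open import Data.Fin.Base using (Fin)
open import Data.Nat.Base using (ℕ)
open import Data.Product.Base using (∃; _×_)
open import Data.Sum.Base using (_⊎_; inj₁; inj₂)
open import Level using (Level; _⊔_; suc)
open import Relation.Binary.Bundles using (Poset)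
open import Relation.Binary.Core using (Rel; _⇒_)
open import Relation.Binary.Definitions using (Maximum)
open import Relation.Binary.Structures using (IsEquivalence)
open import Relation.Unary using (Pred; _∈_; _∪_; _≐_; ⋃)

private
  variable
    c ℓ₁ ℓ₂ ℓ s : Level

-- Only the two relations are taken as parameters, so that the same notions
-- can be used for a quotient before it is known to be a poset.
module OrderNotions {A : Set c} (_≈_ : Rel A ℓ₁) (_≤_ : Rel A ℓ₂) where

  -- Singletons are taken up to the underlying equality _≈_, unlike those of
  -- Relation.Unary, which use _≡_.
  ｛_｝ : A → Pred A ℓ₁
  ｛ a ｝ x = x ≈ a

  -- The set {a₁,…,aₙ}.
  ｛_｝ₙ : {n : ℕ} → (Fin n → A) → Pred A ℓ₁
  ｛_｝ₙ {n} as = ⋃ (Fin n) (λ i → ｛ as i ｝)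

  U : Pred A s → Pred A _
  U S x = ∀ {y} → y ∈ S → y ≤ x

  L : Pred A s → Pred A _
  L S x = ∀ {y} → y ∈ S → x ≤ y

  IsGreatestOf : Pred A s → Pred A _
  IsGreatestOf S g = g ∈ S × g ∈ U S

  UpDirected : Pred A s → Set _
  UpDirected S = ∀ {x y} → x ∈ S → y ∈ S → ∃ λ z → z ∈ S × x ≤ z × y ≤ z

  Comparable : Rel A _
  Comparable x y = x ≤ y ⊎ y ≤ x

  min : ∀ {x y} → Comparable x y → A
  min {x} {y} (inj₁ x≤y) = x
  min {x} {y} (inj₂ y≤x) = y

  MinStable : Rel A ℓ → Set _
  MinStable _ρ_ = ∀ {a b c d} → a ρ b → c ρ d →
    (a∥c : Comparable a c) (b∥d : Comparable b d) → min a∥c ρ min b∥d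

module _ (P : Poset c ℓ₁ ℓ₂) where
  open Poset P
  open OrderNotions _≈_ _≤_

  IsSectionalPseudocomplementation : Op₂ Carrier → Set _
  IsSectionalPseudocomplementation _*_ = ∀ a b →
    IsGreatestOf (λ x → L (U (｛ a ｝ ∪ ｛ b ｝) ∪ ｛ x ｝) ≐ L ｛ b ｝) (a * b)

record StronglySectionallyPseudocomplementedPoset c ℓ₁ ℓ₂ : Set (suc (c ⊔ ℓ₁ ⊔ ℓ₂)) where
  infixl 7 _*_
  field
    poset : Poset c ℓ₁ ℓ₂
  open Poset poset public
  field
    _*_    : Op₂ Carrier
    1#     : Carrier
    isSectionalPseudocomplementation : IsSectionalPseudocomplementation poset _*_
    maximum : Maximum _≤_ 1#
    strong  : ∀ x y → x ≤ (x * y) * y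
  open OrderNotions _≈_ _≤_ public

module _ (𝐏 : StronglySectionallyPseudocomplementedPoset c ℓ₁ ℓ₂) where
  open StronglySectionallyPseudocomplementedPoset 𝐏

  -- As equality on 𝐏 is a setoid equality, a congruence must contain it
  -- (the field reflexive).
  record Con ℓ : Set (c ⊔ ℓ₁ ⊔ ℓ₂ ⊔ suc ℓ) where
    infix 4 _∼_
    field
      _∼_           : Rel Carrier ℓ
      isEquivalence : IsEquivalence _∼_
      reflexive     : _≈_ ⇒ _∼_
      *-cong        : Congruent₂ _∼_ _*_
      minStable     : MinStable _∼_

-- The quotient is the setoid on the same carrier whose equality is Θ, so that
-- [ a ] and [ b ] are equal exactly when (a , b) ∈ Θ.
module Quotient {𝐏 : StronglySectionallyPseudocomplementedPoset c ℓ₁ ℓ₂}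
                (Θ : Con 𝐏 ℓ) where
  private
    module P = StronglySectionallyPseudocomplementedPoset 𝐏
    module Θ = Con Θ

  P/Θ : Magma c ℓ
  P/Θ = record
    { Carrier = P.Carrier
    ; _≈_     = Θ._∼_
    ; _∙_     = P._*_
    ; isMagma = record { isEquivalence = Θ.isEquivalence ; ∙-cong = Θ.*-cong }
    }

  open Magma P/Θ public using () renaming (Carrier to Carrier/; _≈_ to _≈/_; _∙_ to _*/_)

  [_] : P.Carrier → Carrier/
  [ a ] = a

  infix 4 _≤′_
  _≤′_ : Rel Carrier/ ℓ
  x ≤′ y = x */ y ≈/ [ P.1# ]

  -- The class of a as a subset of P, as opposed to the element [ a ] of P/Θ.
  class : P.Carrier → Pred P.Carrier ℓ
  class a x = x Θ.∼ a

  -- {[x]Θ | x ∈ S}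
  image : Pred P.Carrier s → Pred Carrier/ _
  image S y = ∃ λ x → x ∈ S × y ≈/ [ x ]

  open OrderNotions _≈/_ _≤′_ public using ()
    renaming (U to U/; ｛_｝ₙ to ｛_｝ₙ/)

{-# OPTIONS --safe #-}
-- For comparing classes, the term (a * b) * b plays the role of a join: it is an
-- upper bound of a and b, and it is congruent to 1 * b = b as soon as [a] ≤′ [b].
-- So [a] ≤′ [b] means that a lies below some member of [b], which reduces the
-- claims to ≤; only antisymmetry needs min-stability.
module Submission where

open import Data.Fin.Base using (Fin; zero; suc)
open import Data.Nat.Base as ℕ using (ℕ; zero; suc)
open import Data.Product.Base using (∃; _×_; _,_; proj₁; proj₂)
open import Data.Sum.Base using (inj₁; inj₂)
open import Function.Base using (_∘_)
open import Function.Bundles using (_⇔_; mk⇔)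
open import Level using (Level)
open import Relation.Binary.Bundles using (Poset)
open import Relation.Binary.Structures using (IsEquivalence; IsPartialOrder)
open import Relation.Unary using (Pred; _∈_; _≐_)
open import Defs

private
  variable
    c ℓ₁ ℓ₂ ℓ s : Level

module _ (P : Poset c ℓ₁ ℓ₂) where
  open Poset P
  open OrderNotions _≈_ _≤_

  -- Induction on `n`; the given inhabitant of `S` serves as the bound of the empty family.
  upDirected⇒finiteBound : {S : Pred Carrier s} → UpDirected S → ∃ S →
    ∀ {n} (xs : Fin n → Carrier) → (∀ i → xs i ∈ S) →
    ∃ λ z → z ∈ S × (∀ i → xs i ≤ z)
  upDirected⇒finiteBound dir (z , z∈S) {zero} xs xs∈S = z , z∈S , λ ()
  upDirected⇒finiteBound dir inh {suc n} xs xs∈S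
    with y , y∈S , xs≤y ← upDirected⇒finiteBound dir inh (xs ∘ suc) (xs∈S ∘ suc)
    with z , z∈S , x≤z , y≤z ← dir (xs∈S zero) y∈S
    = z , z∈S , λ { zero → x≤z ; (suc i) → trans (xs≤y i) y≤z }

module SectionalProperties (𝐏 : StronglySectionallyPseudocomplementedPoset c ℓ₁ ℓ₂) where
  open StronglySectionallyPseudocomplementedPoset 𝐏

  -- Since `y` is in `L ｛ y ｝`, the equation defining `x * y` puts `y` among the lower bounds of a
  -- set containing `x * y`.
  y≤x*y : ∀ x y → y ≤ x * y
  y≤x*y x y =
    proj₂ (proj₁ (isSectionalPseudocomplementation x y))
      (λ z≈y → reflexive (Eq.sym z≈y)) (inj₂ Eq.refl)

  -- When `x ≤ y`, `y` itself belongs to `U(x,y)`, so `1#` satisfies the equation defining `x * y`,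
  -- whose greatest solution is then `1#`.
  x≤y⇒x*y≈1 : ∀ {x y} → x ≤ y → x * y ≈ 1#
  x≤y⇒x*y≈1 {x} {y} x≤y = antisym (maximum (x * y))
    (proj₂ (isSectionalPseudocomplementation x y)
      ( (λ w∈L z≈y → trans
            (w∈L (inj₁ λ { (inj₁ u≈x) → trans (reflexive u≈x) x≤y
                         ; (inj₂ u≈y) → reflexive u≈y }))
            (reflexive (Eq.sym z≈y)))
      , λ w∈L → λ { (inj₁ u∈U) → trans (w∈L Eq.refl) (u∈U (inj₂ Eq.refl))
                  ; (inj₂ u≈1) → trans (maximum _) (reflexive (Eq.sym u≈1)) }))

  -- Every member of `U(1,x)` lies above `1#`, so `1# * x` is in `L(U(1,x), 1*x) = L(x)`.
  1*x≈x : ∀ x → 1# * x ≈ x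
  1*x≈x x = antisym
    (proj₁ (proj₁ (isSectionalPseudocomplementation 1# x))
      (λ { (inj₁ u∈U) → trans (maximum _) (u∈U (inj₁ Eq.refl))
         ; (inj₂ u≈1*x) → reflexive (Eq.sym u≈1*x) })
      Eq.refl)
    (y≤x*y 1# x)

module QuotientProperties {𝐏 : StronglySectionallyPseudocomplementedPoset c ℓ₁ ℓ₂}
                          (Θ : Con 𝐏 ℓ) where
  open StronglySectionallyPseudocomplementedPoset 𝐏 hiding (_∼_; isEquivalence)
  open SectionalProperties 𝐏
  open Quotient Θ
  open Con Θ using (_∼_; isEquivalence; *-cong; minStable) renaming (reflexive to ≈⇒∼)
  private module ∼ = IsEquivalence isEquivalence

  ≤⇒≤′ : ∀ {a b} → a ≤ b → [ a ] ≤′ [ b ]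
  ≤⇒≤′ = ≈⇒∼ ∘ x≤y⇒x*y≈1

  ≤′-resp-∼ : ∀ {a a′ b b′} → a ∼ a′ → b ∼ b′ → a ≤′ b → a′ ≤′ b′
  ≤′-resp-∼ a∼a′ b∼b′ a≤′b = ∼.trans (∼.sym (*-cong a∼a′ b∼b′)) a≤′b

  [x*y]*y∈class : ∀ {x y} → x ≤′ y → (x * y) * y ∈ class y
  [x*y]*y∈class {y = y} x≤′y = ∼.trans (*-cong x≤′y ∼.refl) (≈⇒∼ (1*x≈x y))

  ≤′⇒∃≤ : ∀ {a b} → a ≤′ b → ∃ λ d → d ∈ class b × a ≤ d
  ≤′⇒∃≤ {a} {b} a≤′b = (a * b) * b , [x*y]*y∈class a≤′b , strong a b

  ∃≤⇒≤′ : ∀ {a b} → (∃ λ d → d ∈ class b × a ≤ d) → a ≤′ b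
  ∃≤⇒≤′ (d , d∼b , a≤d) = ≤′-resp-∼ ∼.refl d∼b (≤⇒≤′ a≤d)

  ≤′-reflexive : ∀ {a b} → a ∼ b → a ≤′ b
  ≤′-reflexive a∼b = ≤′-resp-∼ ∼.refl a∼b (≤⇒≤′ refl)

  ≤′-trans : ∀ {a b d} → a ≤′ b → b ≤′ d → a ≤′ d
  ≤′-trans a≤′b b≤′d
    with b₁ , b₁∼b , a≤b₁ ← ≤′⇒∃≤ a≤′b
    -- Restating `b ≤′ d` for the representative `b₁` makes the two inequalities in `P` meet at the
    -- same element.
    with d₁ , d₁∼d , b₁≤d₁ ← ≤′⇒∃≤ (≤′-resp-∼ (∼.sym b₁∼b) ∼.refl b≤′d)
    = ∃≤⇒≤′ (d₁ , d₁∼d , trans a≤b₁ b₁≤d₁)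

  -- Min-stability is applied to the pairs `(x , z)` and `(y , y)`: the minima are `x` on the left
  -- and `y` on the right.
  ∼-convex : ∀ {x y z} → x ≤ y → y ≤ z → x ∼ z → x ∼ y
  ∼-convex x≤y y≤z x∼z = minStable x∼z ∼.refl (inj₁ x≤y) (inj₂ y≤z)

  ≤′-antisym : ∀ {a b} → a ≤′ b → b ≤′ a → a ∼ b
  ≤′-antisym a≤′b b≤′a
    with b₁ , b₁∼b , a≤b₁ ← ≤′⇒∃≤ a≤′b
    with a₁ , a₁∼a , b₁≤a₁ ← ≤′⇒∃≤ (≤′-resp-∼ (∼.sym b₁∼b) ∼.refl b≤′a)
    -- Here `a ≤ b₁ ≤ a₁` with both ends in the class of `a`, so convexity puts `b₁` there too.
    = ∼.trans (∼-convex a≤b₁ b₁≤a₁ (∼.sym a₁∼a)) b₁∼b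

  ≤′-isPartialOrder : IsPartialOrder _≈/_ _≤′_
  ≤′-isPartialOrder = record
    { isPreorder = record
      { isEquivalence = isEquivalence
      ; reflexive     = ≤′-reflexive
      ; trans         = ≤′-trans
      }
    ; antisym = ≤′-antisym
    }

  -- Congruent `y` and `z` satisfy `y ≤′ z`, so their upper bound `(y * z) * z` stays in the class
  -- of `z`.
  class-upDirected : ∀ x → UpDirected (class x)
  class-upDirected x {y} {z} y∼x z∼x =
    (y * z) * z
    , ∼.trans ([x*y]*y∈class (≤′-reflexive (∼.trans y∼x (∼.sym z∼x)))) z∼x
    , strong y z
    , y≤x*y (y * z) z

  U/≐image-U : ∀ {n} (as : Fin n → Carrier) →
    U/ ｛ (λ i → [ as i ]) ｝ₙ/ ≐ image (U ｛ as ｝ₙ)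
  U/≐image-U as = to , from
    where
    to : ∀ {y} → y ∈ U/ ｛ as ｝ₙ/ → y ∈ image (U ｛ as ｝ₙ)
    to {y} y∈U/
      -- Each `as i` lies below `(as i * y) * y`, a member of the class of `y`. Directedness bounds
      -- these `n` members by a single `x` of that class, so `x` is a common upper bound in `P`
      -- representing `[ y ]`.
      with x , x∼y , ds≤x ← upDirected⇒finiteBound poset (class-upDirected y) (y , ∼.refl)
             (λ i → (as i * y) * y) (λ i → [x*y]*y∈class (y∈U/ (i , ∼.refl)))
      = x
      , (λ { (i , z≈aᵢ) → trans (reflexive z≈aᵢ) (trans (strong (as i) y) (ds≤x i)) })
      , ∼.sym x∼y

    from : ∀ {y} → y ∈ image (U ｛ as ｝ₙ) → y ∈ U/ ｛ as ｝ₙ/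
    from (x , x∈U , y∼x) (i , z∼aᵢ) =
      ≤′-resp-∼ (∼.sym z∼aᵢ) (∼.sym y∼x) (≤⇒≤′ (x∈U (i , Eq.refl)))

theorem4p2 : ∀ {c ℓ₁ ℓ₂ ℓ}
    (𝐏 : StronglySectionallyPseudocomplementedPoset c ℓ₁ ℓ₂) →
    let open StronglySectionallyPseudocomplementedPoset 𝐏 in
    (n : ℕ) → 1 ℕ.≤ n → (a : Carrier) (as : Fin n → Carrier) (b : Carrier) (Θ : Con 𝐏 ℓ) →
    let open Quotient Θ in
    (a ≤ b → [ a ] ≤′ [ b ])
    × ([ a ] ≤′ [ b ] ⇔ (∃ λ c → c ∈ class b × a ≤ c))
    × IsPartialOrder _≈/_ _≤′_
    × (∀ x → UpDirected (class x))
    × (U/ ｛ (λ i → [ as i ]) ｝ₙ/ ≐ image (U ｛ as ｝ₙ))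
theorem4p2 𝐏 n 1≤n a as b Θ =
  ≤⇒≤′ , mk⇔ ≤′⇒∃≤ ∃≤⇒≤′ , ≤′-isPartialOrder , class-upDirected , U/≐image-U as
  where open QuotientProperties Θ
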